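{- Let $m,n$ be integers with $m\geq n\geq 1$ and let $\beta>1$ be the root of $x^2-mx-n$ that is greater than $1$. Then $\mathrm{Fin}(-\beta)$ is closed under addition, i.e. $x+y\in\mathrm{Fin}(-\beta)$ for all $x,y\in\mathrm{Fin}(-\beta)$.
   Context: Ito–Sadahiro $(-\beta)$-expansions. For real $\beta>1$ put $l_\beta=-\frac{\beta}{\beta+1}$, $r_\beta=1+l_\beta=\frac{1}{\beta+1}$, and define $T_{ -\beta}:[l_\beta,r_\beta)\to[l_\beta,r_\beta)$ by $T_{ -\beta}(y)=-\beta y-\lfloor-\beta y-l_\beta\rfloor$. For $y\in[l_\beta,r_\beta)$ put $d_{ -\beta}(y)=y_1y_2y_3\cdots$ where $y_i=\lfloor-\beta T_{ -\beta}^{i-1}(y)-l_\beta\rfloor$ for $i\ge1$; then $y=\sum_{i\ge1}y_i(-\beta)^{ -i}$. For $x\in\mathbb{R}$, a $(-\beta)$-representation of $x$ is an expression $x=\sum_{i=-\infty}^{k}x_i(-\beta)^i$ with $k\in\mathbb{Z}$ and $x_i\in\mathbb{Z}$. The $(-\beta)$-expansion of $x$ is the $(-\beta)$-representation for which $x_kx_{k-1}x_{k-2}\cdots=d_{ -\beta}(y)$ for some $y$ in the open interval $(l_\beta,r_\beta)$; it exists and is unique up to leading zeros. The set $\mathbb{Z}_{ -\beta}$ of $(-\beta)$-integers consists of all $x\in\mathbb{R}$ whose $(-\beta)$-expansion has $x_i=0$ for all $i<0$, and $\mathrm{Fin}(-\beta)=\bigcup_{k\in\mathbb{Z}}(-\beta)^k\mathbb{Z}_{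 -\beta}$ is the set of numbers with finite $(-\beta)$-expansion. -}

module Defs where

open import Algebra.Bundles using (CommutativeRing; Semiring)
import Algebra.Definitions.RawSemiring as RawSemiringDefinitions
open import Data.Fin.Base using (toℕ)
open import Data.Integer.Base as ℤ using (ℤ; +_; -[1+_])
open import Data.Nat.Base as ℕ using (ℕ; zero; suc)
open import Data.Product.Base using (_×_; ∃-syntax)
open import Level using (Level; _⊔_) renaming (suc to lsuc)
open import Relation.Binary.Core using (Rel)
import Relation.Binary.Construct.StrictToNonStrict as StrictToNonStrict
open import Relation.Binary.PropositionalEquality.Core using (_≡_)
open import Relation.Binary.Structures using (IsStrictTotalOrder)

record OrderedField (c ℓ₁ ℓ₂ : Level) : Set (lsuc (c ⊔ ℓ₁ ⊔ ℓ₂)) where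
  infix 4 _<_
  infix 9 _⁻¹
  field
    commutativeRing : CommutativeRing c ℓ₁

  open CommutativeRing commutativeRing public

  field
    _<_                : Rel Carrier ℓ₂
    isStrictTotalOrder : IsStrictTotalOrder _≈_ _<_
    0<1                : 0# < 1#
    +-monoʳ-<          : ∀ x {y z} → y < z → x + y < x + z
    *-pos              : ∀ {x y} → 0# < x → 0# < y → 0# < x * y
    -- The inverse is a total operation whose value at 0# is unspecified.
    _⁻¹                : Carrier → Carrier
    ⁻¹-cong            : ∀ {x y} → x ≈ y → x ⁻¹ ≈ y ⁻¹
    ⁻¹-inverseʳ        : ∀ {x} → x ≉ 0# → x * x ⁻¹ ≈ 1#

  open StrictToNonStrict _≈_ _<_ public using (_≤_)
  open RawSemiringDefinitions (Semiring.rawSemiring semiring) public using (_^_; sum)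
    renaming (_×_ to _·_)

  infixl 7 _/_
  _/_ : Carrier → Carrier → Carrier
  x / y = x * y ⁻¹

  fromℤ : ℤ → Carrier
  fromℤ (+ n)    = n · 1#
  fromℤ -[1+ n ] = - (suc n · 1#)

  infixr 8 _^ℤ_
  _^ℤ_ : Carrier → ℤ → Carrier
  x ^ℤ (+ n)    = x ^ n
  x ^ℤ -[1+ n ] = (x ⁻¹) ^ suc n

-- The standard library has no real numbers, so results about ℝ are stated for
-- every ordered field with a floor function, of which ℝ is one.  (Classically,
-- an ordered field has a floor function exactly when it is Archimedean, that
-- is, isomorphic to a subfield of ℝ.)
record ArchimedeanOrderedField (c ℓ₁ ℓ₂ : Level) : Set (lsuc (c ⊔ ℓ₁ ⊔ ℓ₂)) where
  field
    orderedField : OrderedField c ℓ₁ ℓ₂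

  open OrderedField orderedField public

  field
    ⌊_⌋      : Carrier → ℤ
    ⌊⌋-lower : ∀ x → fromℤ ⌊ x ⌋ ≤ x
    ⌊⌋-upper : ∀ x → x < fromℤ ⌊ x ⌋ + 1#

module Expansion {c ℓ₁ ℓ₂} (K : ArchimedeanOrderedField c ℓ₁ ℓ₂)
                 (β : ArchimedeanOrderedField.Carrier K) where
  open ArchimedeanOrderedField K

  lᵦ : Carrier
  lᵦ = - (β / (β + 1#))

  rᵦ : Carrier
  rᵦ = 1# + lᵦ

  -- The formula for T makes sense everywhere; the transformation of the
  -- interval [lᵦ , rᵦ) is its restriction, and only that restriction is used
  -- below.
  T : Carrier → Carrier
  T y = (- β) * y - fromℤ ⌊ (- β) * y - lᵦ ⌋

  T^ : ℕ → Carrier → Carrier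
  T^ zero    y = y
  T^ (suc i) y = T (T^ i y)

  -- d y i is the digit y_{i+1} : digits are indexed from 0 here.
  d : Carrier → ℕ → ℤ
  d y i = ⌊ (- β) * T^ i y - lᵦ ⌋

  -- A representation x = Σ_{i ≤ k} x_i (-β)^i is given by k and the sequence
  -- a j = x_{k-j}, i.e. digits are listed from the leading one downwards.
  partialSum : ℤ → (ℕ → ℤ) → ℕ → Carrier
  partialSum k a N =
    sum {N} (λ j → fromℤ (a (toℕ j)) * (- β) ^ℤ (k ℤ.- + toℕ j))

  IsRepresentation : Carrier → ℤ → (ℕ → ℤ) → Set (c ⊔ ℓ₂)
  IsRepresentation x k a =
    ∀ ε → 0# < ε → ∃[ N₀ ] ∀ N → N₀ ℕ.≤ N →
      (- ε < partialSum k a N - x) × (partialSum k a N - x < ε)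

  IsExpansion : Carrier → ℤ → (ℕ → ℤ) → Set (c ⊔ ℓ₂)
  IsExpansion x k a =
    IsRepresentation x k a ×
    ∃[ y ] (lᵦ < y) × (y < rᵦ) × (∀ j → a j ≡ d y j)

  -- Expansions of x differ only by leading zeros, so asking for some expansion
  -- with the required property is the same as asking it of every expansion.
  ℤ₋ᵦ : Carrier → Set (c ⊔ ℓ₂)
  ℤ₋ᵦ x = ∃[ k ] ∃[ a ] IsExpansion x k a ×
          (∀ j → k ℤ.- + j ℤ.< + 0 → a j ≡ + 0)

  Fin₋ᵦ : Carrier → Set (c ⊔ ℓ₁ ⊔ ℓ₂)
  Fin₋ᵦ x = ∃[ k ] ∃[ z ] ℤ₋ᵦ z × (x ≈ (- β) ^ℤ k * z)

{-# OPTIONS --safe #-}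

-- Write B = - β and call x finite if x = B ^ k y
-- with y inside (lᵦ , rᵦ) and T ^ N y = 0 for some N.  Elements of Fin(-β) are
-- finite sums of terms d B ^ j with digits d ≥ 0, so it is enough that finite
-- numbers stay finite when 1 is added.  To see this, compare the orbit of
-- s = y + B ^ (-2j) with the orbit of y.  After i steps they differ by
-- a - b β + B ^ (i - 2j) with integers a, b (for i > 2j by a' - b β only), and b
-- evolves by b ↦ a - b m = s - y - g + b γ, where g is the power of B and
-- γ = β - m = n / β lies in (0 , 1).  Since s - y > lᵦ - rᵦ = -1, this keeps b ≥ 0,
-- apart from a drop to -1 that is repaired in the next step.  Once the orbit of y
-- is at 0, the orbit of s consists of numbers a - b β with b ≥ 0, and b strictly
-- decreases because rᵦ ≤ 1 - γ, which is where m ≥ n enters.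
module Submission where

open import Defs
open import Algebra.Bundles using (CommutativeRing)
import Algebra.Properties.AbelianGroup as AbelianGroupProperties
import Algebra.Properties.CommutativeSemigroup as CommutativeSemigroupProperties
import Algebra.Properties.CommutativeSemiring.Exp as Exp
open import Algebra.Properties.Monoid.Sum using (sum-cong-≋)
import Algebra.Properties.Ring as RingProperties
import Algebra.Properties.Semiring.Mult as Mult
import Algebra.Properties.Semiring.Mult.TCOptimised as MultTCOptimised
import Algebra.Solver.Ring as RingSolver
open import Algebra.Solver.Ring.AlmostCommutativeRing
  using (fromCommutativeRing; _-Raw-AlmostCommutative⟶_)
open import Data.Empty using (⊥-elim)
open import Data.Fin.Base as Fin using (Fin; toℕ)
open import Data.Integer.Base as ℤ using (ℤ; +_; -[1+_]; _⊖_)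
import Data.Integer.Properties as ℤ
open import Data.Maybe.Base using (Maybe; just; nothing)
open import Data.Nat.Base as ℕ using (ℕ; zero; suc)
import Data.Nat.Properties as ℕ
open import Data.Product.Base using (_×_; _,_; ∃-syntax; proj₁; proj₂)
open import Data.Sum.Base using (inj₁; inj₂)
import Relation.Binary.Construct.StrictToNonStrict as StrictToNonStrict
open import Relation.Binary.Definitions using (tri<; tri≈; tri>)
import Relation.Binary.PropositionalEquality as ≡
open ≡ using (_≡_)
import Relation.Binary.Reasoning.Setoid as SetoidReasoning
open import Relation.Binary.Structures using (IsStrictTotalOrder)
open import Relation.Nullary using (yes; no; ¬_)

-- Integers, order and powers in an ordered field.

module OrderedFieldProperties {c ℓ₁ ℓ₂} (F : OrderedField c ℓ₁ ℓ₂) where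
  open OrderedField F
  open RingProperties ring
    using (-‿distribˡ-*; -0#≈0#; -‿involutive)
  open AbelianGroupProperties +-abelianGroup using () renaming (⁻¹-∙-comm to -‿+-comm)
  open CommutativeSemigroupProperties +-commutativeSemigroup
    using () renaming (interchange to +-interchange)
  open Mult semiring using (×-homo-+)
  open MultTCOptimised semiring using () renaming (_×_ to _×′_; ×ᵤ≈× to ×≈×′)
  open SetoidReasoning setoid
  open IsStrictTotalOrder isStrictTotalOrder public
    using (compare; <-respʳ-≈; <-respˡ-≈)
    renaming (trans to <-trans; irrefl to <-irrefl; asym to <-asym)

  fromℤ-⊖ : ∀ m n → fromℤ (m ⊖ n) ≈ m · 1# - n · 1#
  fromℤ-⊖ m       zero    = sym (trans (+-congˡ -0#≈0#) (+-identityʳ _))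
  fromℤ-⊖ zero    (suc n) = sym (+-identityˡ _)
  fromℤ-⊖ (suc m) (suc n) = begin
    fromℤ (suc m ⊖ suc n)               ≡⟨ ≡.cong fromℤ (ℤ.[1+m]⊖[1+n]≡m⊖n m n) ⟩
    fromℤ (m ⊖ n)                       ≈⟨ fromℤ-⊖ m n ⟩
    m · 1# - n · 1#                     ≈⟨ +-identityˡ _ ⟨
    0# + (m · 1# - n · 1#)              ≈⟨ +-congʳ (-‿inverseʳ 1#) ⟨
    (1# - 1#) + (m · 1# - n · 1#)       ≈⟨ +-interchange 1# (- 1#) (m · 1#) (- (n · 1#)) ⟩
    suc m · 1# + (- 1# + - (n · 1#))    ≈⟨ +-congˡ (-‿+-comm 1# (n · 1#)) ⟩
    suc m · 1# - suc n · 1#             ∎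

  fromℤ-+ : ∀ i j → fromℤ (i ℤ.+ j) ≈ fromℤ i + fromℤ j
  fromℤ-+ (+ m)    (+ n)    = ×-homo-+ 1# m n
  fromℤ-+ (+ m)    -[1+ n ] = fromℤ-⊖ m (suc n)
  fromℤ-+ -[1+ m ] (+ n)    = trans (fromℤ-⊖ n (suc m)) (+-comm _ _)
  fromℤ-+ -[1+ m ] -[1+ n ] = begin
    - (suc (suc (m ℕ.+ n)) · 1#)      ≈⟨ -‿cong (+-congˡ (×-homo-+ 1# (suc m) n)) ⟩
    - (1# + (suc m · 1# + n · 1#))    ≈⟨ -‿cong (+-congˡ (+-comm _ _)) ⟩
    - (1# + (n · 1# + suc m · 1#))    ≈⟨ -‿cong (+-assoc _ _ _) ⟨
    - (suc n · 1# + suc m · 1#)       ≈⟨ -‿cong (+-comm _ _) ⟩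
    - (suc m · 1# + suc n · 1#)       ≈⟨ -‿+-comm _ _ ⟨
    - (suc m · 1#) - suc n · 1#       ∎

  fromℤ-neg : ∀ i → fromℤ (ℤ.- i) ≈ - fromℤ i
  fromℤ-neg (+ zero)  = sym -0#≈0#
  fromℤ-neg (+ suc n) = refl
  fromℤ-neg -[1+ n ]  = sym (-‿involutive _)

  fromℤ-*⁺ : ∀ m j → fromℤ (+ m ℤ.* j) ≈ fromℤ (+ m) * fromℤ j
  fromℤ-*⁺ zero    j = sym (zeroˡ _)
  fromℤ-*⁺ (suc m) j = begin
    fromℤ (+ suc m ℤ.* j)                  ≡⟨ ≡.cong fromℤ (ℤ.suc-* (+ m) j) ⟩
    fromℤ (j ℤ.+ + m ℤ.* j)                ≈⟨ fromℤ-+ j (+ m ℤ.* j) ⟩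
    fromℤ j + fromℤ (+ m ℤ.* j)            ≈⟨ +-cong (sym (*-identityˡ _)) (fromℤ-*⁺ m j) ⟩
    1# * fromℤ j + fromℤ (+ m) * fromℤ j   ≈⟨ distribʳ _ _ _ ⟨
    fromℤ (+ suc m) * fromℤ j              ∎

  fromℤ-* : ∀ i j → fromℤ (i ℤ.* j) ≈ fromℤ i * fromℤ j
  fromℤ-* (+ m)    j = fromℤ-*⁺ m j
  fromℤ-* -[1+ m ] j = begin
    fromℤ (-[1+ m ] ℤ.* j)          ≡⟨ ≡.cong fromℤ (ℤ.neg-distribˡ-* (+ suc m) j) ⟨
    fromℤ (ℤ.- (+ suc m ℤ.* j))     ≈⟨ fromℤ-neg (+ suc m ℤ.* j) ⟩
    - fromℤ (+ suc m ℤ.* j)         ≈⟨ -‿cong (fromℤ-*⁺ (suc m) j) ⟩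
    - (fromℤ (+ suc m) * fromℤ j)   ≈⟨ -‿distribˡ-* _ _ ⟩
    fromℤ -[1+ m ] * fromℤ j        ∎

  fromℤ-- : ∀ i j → fromℤ (i ℤ.- j) ≈ fromℤ i - fromℤ j
  fromℤ-- i j = trans (fromℤ-+ i (ℤ.- j)) (+-congˡ (fromℤ-neg j))

  fromℤ-1 : fromℤ (+ 1) ≈ 1#
  fromℤ-1 = +-identityʳ 1#

  -- Unlike fromℤ, this embedding sends 1 to 1# definitionally, so that the
  -- constants of solver goals are literally 0# and 1#.
  private
    fromℤ′ : ℤ → Carrier
    fromℤ′ (+ n)    = n ×′ 1#
    fromℤ′ -[1+ n ] = - (suc n ×′ 1#)

    fromℤ≈fromℤ′ : ∀ i → fromℤ i ≈ fromℤ′ i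
    fromℤ≈fromℤ′ (+ n)    = ×≈×′ n 1#
    fromℤ≈fromℤ′ -[1+ n ] = -‿cong (×≈×′ (suc n) 1#)

    morphism : CommutativeRing.rawRing ℤ.+-*-commutativeRing
                 -Raw-AlmostCommutative⟶ fromCommutativeRing commutativeRing
    morphism = record
      { ⟦_⟧    = fromℤ′
      ; +-homo = λ i j → hom (i ℤ.+ j) (fromℤ-+ i j) (+-cong (fromℤ≈fromℤ′ i) (fromℤ≈fromℤ′ j))
      ; *-homo = λ i j → hom (i ℤ.* j) (fromℤ-* i j) (*-cong (fromℤ≈fromℤ′ i) (fromℤ≈fromℤ′ j))
      ; -‿homo = λ i → hom (ℤ.- i) (fromℤ-neg i) (-‿cong (fromℤ≈fromℤ′ i))
      ; 0-homo = refl
      ; 1-homo = refl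
      }
      where
      hom : ∀ {x y} i → fromℤ i ≈ x → x ≈ y → fromℤ′ i ≈ y
      hom i p q = trans (sym (fromℤ≈fromℤ′ i)) (trans p q)

    _≟′_ : ∀ i j → Maybe (fromℤ′ i ≈ fromℤ′ j)
    i ≟′ j with i ℤ.≟ j
    ... | yes ≡.refl = just refl
    ... | no  _      = nothing

  open RingSolver (CommutativeRing.rawRing ℤ.+-*-commutativeRing)
    (fromCommutativeRing commutativeRing) morphism _≟′_ public
    using (solve; _:=_; _:+_; _:*_; _:-_; :-_; con)

  open StrictToNonStrict _≈_ _<_ public using (<⇒≤)

  <-≤-trans : ∀ {x y z} → x < y → y ≤ z → x < z
  <-≤-trans = StrictToNonStrict.<-≤-trans _≈_ _<_ <-trans <-respʳ-≈

  ≤-<-trans : ∀ {x y z} → x ≤ y → y < z → x < z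
  ≤-<-trans = StrictToNonStrict.≤-<-trans _≈_ _<_ sym <-trans <-respˡ-≈

  ≤-respʳ-≈ : ∀ {x y z} → y ≈ z → x ≤ y → x ≤ z
  ≤-respʳ-≈ = StrictToNonStrict.≤-respʳ-≈ _≈_ _<_ trans <-respʳ-≈

  ≤-respˡ-≈ : ∀ {x y z} → y ≈ z → y ≤ x → z ≤ x
  ≤-respˡ-≈ = StrictToNonStrict.≤-respˡ-≈ _≈_ _<_ sym trans <-respˡ-≈

  <⇒≱ : ∀ {x y} → x < y → ¬ y ≤ x
  <⇒≱ x<y (inj₁ y<x) = <-asym x<y y<x
  <⇒≱ x<y (inj₂ y≈x) = <-irrefl (sym y≈x) x<y

  0<y-x : ∀ {x y} → x < y → 0# < y - x
  0<y-x {x} {y} x<y =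
    <-respˡ-≈ (-‿inverseˡ x) (<-respʳ-≈ (+-comm (- x) y) (+-monoʳ-< (- x) x<y))

  0≤y-x : ∀ {x y} → x ≤ y → 0# ≤ y - x
  0≤y-x         (inj₁ x<y) = inj₁ (0<y-x x<y)
  0≤y-x {x} {y} (inj₂ x≈y) = inj₂ (trans (sym (-‿inverseʳ x)) (+-congʳ x≈y))

  -- Inequalities below are proved by writing the gap `e` as a combination of quantities of known
  -- sign; what remains is a ring identity for `solve`.
  <-by-gap : ∀ {x y e} → 0# < e → y ≈ x + e → x < y
  <-by-gap {x} 0<e y≈x+e =
    <-respʳ-≈ (sym y≈x+e) (<-respˡ-≈ (+-identityʳ x) (+-monoʳ-< x 0<e))

  ≤-by-gap : ∀ {x y e} → 0# ≤ e → y ≈ x + e → x ≤ y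
  ≤-by-gap     (inj₁ 0<e) y≈x+e = inj₁ (<-by-gap 0<e y≈x+e)
  ≤-by-gap {x} (inj₂ 0≈e) y≈x+e =
    inj₂ (sym (trans y≈x+e (trans (+-congˡ (sym 0≈e)) (+-identityʳ x))))

  -- Lets `solve`, which knows no hypotheses, exploit `u ≈ v`: the cofactor `k` turns the goal into
  -- a polynomial identity. Nested uses combine several hypotheses.
  ≈-by-multiple : ∀ {x y u v} k → u ≈ v → x ≈ y + k * (u - v) → x ≈ y
  ≈-by-multiple {x} {y} {u} {v} k u≈v x≈ = begin
    x                 ≈⟨ x≈ ⟩
    y + k * (u - v)   ≈⟨ +-congˡ (*-congˡ (trans (+-congʳ u≈v) (-‿inverseʳ v))) ⟩
    y + k * 0#        ≈⟨ +-congˡ (zeroʳ k) ⟩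
    y + 0#            ≈⟨ +-identityʳ y ⟩
    y                 ∎

  pos+nonNeg : ∀ {x y} → 0# < x → 0# ≤ y → 0# < x + y
  pos+nonNeg {x} 0<x 0≤y = <-≤-trans 0<x (≤-by-gap 0≤y refl)

  pos+pos : ∀ {x y} → 0# < x → 0# < y → 0# < x + y
  pos+pos 0<x 0<y = pos+nonNeg 0<x (inj₁ 0<y)

  nonNeg+nonNeg : ∀ {x y} → 0# ≤ x → 0# ≤ y → 0# ≤ x + y
  nonNeg+nonNeg         (inj₁ 0<x) 0≤y = inj₁ (pos+nonNeg 0<x 0≤y)
  nonNeg+nonNeg {x} {y} (inj₂ 0≈x) 0≤y =
    ≤-respʳ-≈ (trans (sym (+-identityˡ y)) (+-congʳ 0≈x)) 0≤y

  nonNeg*nonNeg : ∀ {x y} → 0# ≤ x → 0# ≤ y → 0# ≤ x * y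
  nonNeg*nonNeg         (inj₁ 0<x) (inj₁ 0<y) = inj₁ (*-pos 0<x 0<y)
  nonNeg*nonNeg {x} {y} (inj₁ 0<x) (inj₂ 0≈y) = inj₂ (trans (sym (zeroʳ x)) (*-congˡ 0≈y))
  nonNeg*nonNeg {x} {y} (inj₂ 0≈x) _          = inj₂ (trans (sym (zeroˡ y)) (*-congʳ 0≈x))

  nonNeg-0 : 0# ≤ 0#
  nonNeg-0 = inj₂ refl

  -- If y < 0 then 0 < x (0 - y) + x y = 0.
  pos-factor : ∀ {x y} → 0# < x → 0# < x * y → 0# < y
  pos-factor {x} {y} 0<x 0<xy with compare 0# y
  ... | tri< 0<y _ _ = 0<y
  ... | tri≈ _ 0≈y _ = ⊥-elim (<-irrefl (trans (sym (zeroʳ x)) (*-congˡ 0≈y)) 0<xy)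
  ... | tri> _ _ y<0 = ⊥-elim (<-irrefl
    (solve 2 (λ x y → con (+ 0) := x :* (con (+ 0) :- y) :+ x :* y) refl x y)
    (pos+pos (*-pos 0<x (0<y-x y<0)) 0<xy))

  pos⇒≉0 : ∀ {x} → 0# < x → x ≉ 0#
  pos⇒≉0 0<x x≈0 = <-irrefl (sym x≈0) 0<x

  0≤fromℕ : ∀ n → 0# ≤ fromℤ (+ n)
  0≤fromℕ zero    = nonNeg-0
  0≤fromℕ (suc n) = nonNeg+nonNeg (inj₁ 0<1) (0≤fromℕ n)

  fromℤ-mono-≤ : ∀ {i j} → i ℤ.≤ j → fromℤ i ≤ fromℤ j
  fromℤ-mono-≤ {i} {j} i≤j =
    ≤-by-gap (0≤fromℤ (ℤ.i≤j⇒0≤j-i i≤j))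
      (trans (solve 2 (λ x y → y := x :+ (y :- x)) refl (fromℤ i) (fromℤ j))
             (+-congˡ (sym (fromℤ-- j i))))
    where
    0≤fromℤ : ∀ {k} → + 0 ℤ.≤ k → 0# ≤ fromℤ k
    0≤fromℤ {+ n} _ = 0≤fromℕ n

  fromℤ-cancel-< : ∀ {i j} → fromℤ i < fromℤ j → i ℤ.< j
  fromℤ-cancel-< p = ℤ.≰⇒> (λ j≤i → <⇒≱ p (fromℤ-mono-≤ j≤i))

  -- Integrality sharpens a strict bound in the field; the bounds on digits and coefficients below
  -- all arise this way.
  fromℤ-<+1 : ∀ {i j} → fromℤ i < fromℤ j + 1# → i ℤ.≤ j
  fromℤ-<+1 {i} {j} p =
    ≡.subst (i ℤ.≤_) (ℤ.pred-suc j) (ℤ.i<j⇒i≤pred[j] (fromℤ-cancel-< {i} {+ 1 ℤ.+ j} (<-respʳ-≈ eq p)))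
    where
    eq : fromℤ j + 1# ≈ fromℤ (+ 1 ℤ.+ j)
    eq = trans (+-comm _ _) (trans (+-congʳ (sym fromℤ-1)) (sym (fromℤ-+ (+ 1) j)))

  ^-inverse : ∀ {x y} → x * y ≈ 1# → ∀ n → x ^ n * y ^ n ≈ 1#
  ^-inverse         p zero    = *-identityˡ 1#
  ^-inverse {x} {y} p (suc n) = begin
    x * x ^ n * (y * y ^ n)     ≈⟨ solve 4 (λ a b c d → a :* b :* (c :* d) := a :* c :* (b :* d)) refl x (x ^ n) y (y ^ n) ⟩
    x * y * (x ^ n * y ^ n)     ≈⟨ *-cong p (^-inverse p n) ⟩
    1# * 1#                     ≈⟨ *-identityˡ 1# ⟩
    1#                          ∎

  ^ℤ-suc : ∀ {x} → x ≉ 0# → ∀ i → x ^ℤ ℤ.suc i ≈ x * x ^ℤ i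
  ^ℤ-suc     x≉0 (+ n)        = refl
  ^ℤ-suc {x} x≉0 -[1+ zero ]  =
    sym (trans (*-congˡ (*-identityʳ _)) (⁻¹-inverseʳ x≉0))
  ^ℤ-suc {x} x≉0 -[1+ suc n ] = begin
    x ⁻¹ ^ suc n               ≈⟨ *-identityˡ _ ⟨
    1# * x ⁻¹ ^ suc n          ≈⟨ *-congʳ (⁻¹-inverseʳ x≉0) ⟨
    x * x ⁻¹ * x ⁻¹ ^ suc n    ≈⟨ *-assoc _ _ _ ⟩
    x * x ⁻¹ ^ suc (suc n)     ∎

  ^ℤ-+⁺ : ∀ {x} → x ≉ 0# → ∀ m j → x ^ℤ (+ m ℤ.+ j) ≈ x ^ m * x ^ℤ j
  ^ℤ-+⁺ {x} x≉0 zero    j =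
    trans (reflexive (≡.cong (x ^ℤ_) (ℤ.+-identityˡ j))) (sym (*-identityˡ _))
  ^ℤ-+⁺ {x} x≉0 (suc m) j = begin
    x ^ℤ (+ suc m ℤ.+ j)        ≡⟨ ≡.cong (x ^ℤ_) (ℤ.+-assoc (+ 1) (+ m) j) ⟩
    x ^ℤ ℤ.suc (+ m ℤ.+ j)      ≈⟨ ^ℤ-suc x≉0 (+ m ℤ.+ j) ⟩
    x * x ^ℤ (+ m ℤ.+ j)        ≈⟨ *-congˡ (^ℤ-+⁺ x≉0 m j) ⟩
    x * (x ^ m * x ^ℤ j)        ≈⟨ *-assoc _ _ _ ⟨
    x * x ^ m * x ^ℤ j          ∎

  ^ℤ-+ : ∀ {x} → x ≉ 0# → ∀ i j → x ^ℤ (i ℤ.+ j) ≈ x ^ℤ i * x ^ℤ j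
  ^ℤ-+     x≉0 (+ m)    j = ^ℤ-+⁺ x≉0 m j
  ^ℤ-+ {x} x≉0 -[1+ m ] j = begin
    x ^ℤ k                                 ≈⟨ *-identityˡ _ ⟨
    1# * x ^ℤ k                            ≈⟨ *-congʳ (^-inverse (trans (*-comm _ _) (⁻¹-inverseʳ x≉0)) (suc m)) ⟨
    x ⁻¹ ^ suc m * x ^ suc m * x ^ℤ k      ≈⟨ *-assoc _ _ _ ⟩
    x ⁻¹ ^ suc m * (x ^ suc m * x ^ℤ k)    ≈⟨ *-congˡ (^ℤ-+⁺ x≉0 (suc m) k) ⟨
    x ⁻¹ ^ suc m * x ^ℤ (+ suc m ℤ.+ k)    ≡⟨ ≡.cong (λ i → x ⁻¹ ^ suc m * x ^ℤ i) cancel ⟩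
    x ⁻¹ ^ suc m * x ^ℤ j                  ∎
    where
    k = -[1+ m ] ℤ.+ j
    cancel : + suc m ℤ.+ k ≡ j
    cancel = ≡.trans (≡.sym (ℤ.+-assoc (+ suc m) -[1+ m ] j))
      (≡.trans (≡.cong (ℤ._+ j) (ℤ.+-inverseʳ (+ suc m))) (ℤ.+-identityˡ j))

-- The floor function.

module FloorProperties {c ℓ₁ ℓ₂} (K : ArchimedeanOrderedField c ℓ₁ ℓ₂) where
  open ArchimedeanOrderedField K
  open OrderedFieldProperties orderedField

  ⌊⌋-unique : ∀ {k x} → fromℤ k ≤ x → x < fromℤ k + 1# → ⌊ x ⌋ ≡ k
  ⌊⌋-unique {k} {x} k≤x x<k+1 = ℤ.≤-antisym
    (fromℤ-<+1 (≤-<-trans (⌊⌋-lower x) x<k+1))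
    (fromℤ-<+1 (≤-<-trans k≤x (⌊⌋-upper x)))

  ⌊⌋-cong : ∀ {x y} → x ≈ y → ⌊ x ⌋ ≡ ⌊ y ⌋
  ⌊⌋-cong {x} {y} x≈y = ⌊⌋-unique
    (≤-respʳ-≈ (sym x≈y) (⌊⌋-lower y)) (<-respˡ-≈ (sym x≈y) (⌊⌋-upper y))

-- The quadratic base and its constants.

module QuadraticBase {c ℓ₁ ℓ₂} (K : ArchimedeanOrderedField c ℓ₁ ℓ₂) where
  open ArchimedeanOrderedField K
  open OrderedFieldProperties orderedField
  open FloorProperties K
  open RingProperties ring using (-‿involutive; -0#≈0#)
  open Exp commutativeSemiring using (^-homo-*; ^-distrib-*)
  open SetoidReasoning setoid

  module _ (m n : ℤ) (n≤m : n ℤ.≤ m) (1≤n : + 1 ℤ.≤ n) (β : Carrier) (1<β : 1# < β)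
           (root : β ^ 2 - fromℤ m * β - fromℤ n ≈ 0#) where
    open Expansion K β

    private
      -- The other root of the polynomial is `- γ`. `ρ` equals `rᵦ`, and `κ` is 1 / β, written so
      -- that it is literally minus the inverse of `B`.
      μ ν γ ρ κ B : Carrier
      μ = fromℤ m
      ν = fromℤ n
      γ = β - μ
      ρ = (β + 1#) ⁻¹
      κ = - ((- β) ⁻¹)
      B = - β

    0<β : 0# < β
    0<β = <-trans 0<1 1<β

    βγ≈ν : β * γ ≈ ν
    βγ≈ν = ≈-by-multiple 1# root
      (solve 3 (λ β μ ν → β :* (β :- μ) :=
         ν :+ con (+ 1) :* (β :* (β :* con (+ 1)) :- μ :* β :- ν :- con (+ 0))) refl β μ ν)

    0<ν : 0# < ν
    0<ν = <-≤-trans (<-respʳ-≈ (sym fromℤ-1) 0<1) (fromℤ-mono-≤ 1≤n)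

    0<γ : 0# < γ
    0<γ = pos-factor 0<β (<-respʳ-≈ (sym βγ≈ν) 0<ν)

    0≤μ-ν : 0# ≤ μ - ν
    0≤μ-ν = 0≤y-x (fromℤ-mono-≤ n≤m)

    -- Multiplication by `β` turns the right side into `β - ν = γ + (μ - ν)`, and `μ - ν` is
    -- nonnegative.
    0<1-γ : 0# < 1# - γ
    0<1-γ = pos-factor 0<β (<-respʳ-≈ (sym eq) (pos+nonNeg 0<γ 0≤μ-ν))
      where
      eq : β * (1# - γ) ≈ γ + (μ - ν)
      eq = ≈-by-multiple (- 1#) βγ≈ν
        (solve 3 (λ β μ ν → β :* (con (+ 1) :- (β :- μ)) :=
           (β :- μ) :+ (μ :- ν) :+ (:- con (+ 1)) :* (β :* (β :- μ) :- ν)) refl β μ ν)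

    0<β+1 : 0# < β + 1#
    0<β+1 = pos+pos 0<β 0<1

    [β+1]ρ≈1 : (β + 1#) * ρ ≈ 1#
    [β+1]ρ≈1 = ⁻¹-inverseʳ (pos⇒≉0 0<β+1)

    0<ρ : 0# < ρ
    0<ρ = pos-factor 0<β+1 (<-respʳ-≈ (sym [β+1]ρ≈1) 0<1)

    rᵦ≈ρ : rᵦ ≈ ρ
    rᵦ≈ρ = ≈-by-multiple (- 1#) [β+1]ρ≈1
      (solve 2 (λ β ρ → con (+ 1) :- β :* ρ :=
         ρ :+ (:- con (+ 1)) :* ((β :+ con (+ 1)) :* ρ :- con (+ 1))) refl β ρ)

    0<rᵦ : 0# < rᵦ
    0<rᵦ = <-respʳ-≈ (sym rᵦ≈ρ) 0<ρ

    lᵦ≈-βrᵦ : lᵦ ≈ - (β * rᵦ)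
    lᵦ≈-βrᵦ = sym (-‿cong (*-congˡ rᵦ≈ρ))

    lᵦ<0 : lᵦ < 0#
    lᵦ<0 = <-by-gap (*-pos 0<β 0<ρ) (sym (-‿inverseˡ _))

    -- By `βγ≈ν`, `(β + 1) (1 - γ) = 1 + (μ - ν)`; dividing by `β + 1` leaves the gap `ρ (μ - ν)`.
    rᵦ≤1-γ : rᵦ ≤ 1# - γ
    rᵦ≤1-γ = ≤-respˡ-≈ (sym rᵦ≈ρ)
      (≤-by-gap (nonNeg*nonNeg (<⇒≤ 0<ρ) 0≤μ-ν)
        (≈-by-multiple (- (1# - γ)) [β+1]ρ≈1 (≈-by-multiple (- ρ) βγ≈ν
          (solve 4 (λ β μ ν ρ → con (+ 1) :- (β :- μ) :=
             ρ :+ ρ :* (μ :- ν)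
             :+ (:- (con (+ 1) :- (β :- μ))) :* ((β :+ con (+ 1)) :* ρ :- con (+ 1))
             :+ (:- ρ) :* (β :* (β :- μ) :- ν)) refl β μ ν ρ))))

    -- The transformation `T` and orbits that reach 0.

    InRange : Carrier → Set _
    InRange y = lᵦ ≤ y × y < rᵦ

    T-inRange : ∀ y → InRange (T y)
    T-inRange y =
      ≤-by-gap (0≤y-x (⌊⌋-lower (B * y - lᵦ)))
        (solve 3 (λ w k l → w :- k := l :+ (w :- l :- k)) refl (B * y) k lᵦ) ,
      <-by-gap (0<y-x (⌊⌋-upper (B * y - lᵦ)))
        (solve 3 (λ w k l → con (+ 1) :+ l := w :- k :+ (k :+ con (+ 1) :- (w :- l))) refl (B * y) k lᵦ)
      where k = fromℤ ⌊ B * y - lᵦ ⌋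

    -- Since `lᵦ = - β rᵦ`, the number under the floor is `β (rᵦ - y)`. Thanks to this sign, digit
    -- sums can be built by additions alone.
    0≤d₀ : ∀ {y} → y < rᵦ → + 0 ℤ.≤ d y 0
    0≤d₀ {y} y<r = fromℤ-<+1 (<-trans
      (<-respʳ-≈ eq (*-pos 0<β (0<y-x y<r))) (⌊⌋-upper (B * y - lᵦ)))
      where
      eq : β * (rᵦ - y) ≈ B * y - lᵦ
      eq = trans (solve 3 (λ β r y → β :* (r :- y) := (:- β) :* y :- (:- (β :* r))) refl β rᵦ y)
        (+-congˡ (-‿cong (sym lᵦ≈-βrᵦ)))

    d₀≡0 : ∀ {y} → 0# ≤ B * y - lᵦ → B * y - lᵦ < 1# → d y 0 ≡ + 0
    d₀≡0 0≤ <1 = ⌊⌋-unique 0≤ (<-respʳ-≈ (sym (+-identityˡ 1#)) <1)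

    T-shift : ∀ {y} → 0# ≤ B * y - lᵦ → B * y - lᵦ < 1# → T y ≈ B * y
    T-shift {y} 0≤ <1 = trans
      (+-congˡ (-‿cong (reflexive (≡.cong fromℤ (d₀≡0 {y} 0≤ <1)))))
      (solve 1 (λ w → w :- con (+ 0) := w) refl (B * y))

    T-cong : ∀ {x y} → x ≈ y → T x ≈ T y
    T-cong x≈y = +-cong (*-congˡ x≈y)
      (-‿cong (reflexive (≡.cong fromℤ (⌊⌋-cong (+-congʳ (*-congˡ x≈y))))))

    T^-cong : ∀ i {x y} → x ≈ y → T^ i x ≈ T^ i y
    T^-cong zero    x≈y = x≈y
    T^-cong (suc i) x≈y = T-cong (T^-cong i x≈y)

    T^-suc : ∀ i y → T^ (suc i) y ≡ T^ i (T y)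
    T^-suc zero    y = ≡.refl
    T^-suc (suc i) y = ≡.cong T (T^-suc i y)

    By-lᵦ≈-lᵦ : ∀ {y} → y ≈ 0# → B * y - lᵦ ≈ - lᵦ
    By-lᵦ≈-lᵦ {y} y≈0 = trans (+-congʳ (*-congˡ y≈0))
      (solve 2 (λ b l → b :* con (+ 0) :- l := :- l) refl B lᵦ)

    0≤By-lᵦ : ∀ {y} → y ≈ 0# → 0# ≤ B * y - lᵦ
    0≤By-lᵦ y≈0 = <⇒≤ (<-respʳ-≈
      (trans (+-identityˡ _) (sym (By-lᵦ≈-lᵦ y≈0))) (0<y-x lᵦ<0))

    By-lᵦ<1 : ∀ {y} → y ≈ 0# → B * y - lᵦ < 1#
    By-lᵦ<1 y≈0 = <-respˡ-≈ (sym (By-lᵦ≈-lᵦ y≈0)) (<-by-gap 0<rᵦ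
      (solve 1 (λ l → con (+ 1) := :- l :+ (con (+ 1) :+ l)) refl lᵦ))

    d₀[0]≡0 : ∀ {y} → y ≈ 0# → d y 0 ≡ + 0
    d₀[0]≡0 {y} y≈0 = d₀≡0 {y} (0≤By-lᵦ y≈0) (By-lᵦ<1 y≈0)

    -- The number under the floor is `- lᵦ`, which lies in (0, 1), so the digit is 0.
    T[0]≈0 : ∀ {y} → y ≈ 0# → T y ≈ 0#
    T[0]≈0 {y} y≈0 = trans (T-shift (0≤By-lᵦ y≈0) (By-lᵦ<1 y≈0))
      (trans (*-congˡ y≈0) (zeroʳ B))

    Hits0 : Carrier → Set _
    Hits0 y = ∃[ N ] T^ N y ≈ 0#

    Hits0-T⁻¹ : ∀ {y} → Hits0 (T y) → Hits0 y
    Hits0-T⁻¹ {y} (N , p) = suc N , trans (reflexive (T^-suc N y)) p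

    Hits0-T : ∀ {y} → Hits0 y → Hits0 (T y)
    -- The same `N` serves, because `T` fixes 0.
    Hits0-T {y} (N , p) = N , trans (reflexive (≡.sym (T^-suc N y))) (T[0]≈0 p)

    Hits0-cong : ∀ {x y} → x ≈ y → Hits0 x → Hits0 y
    Hits0-cong x≈y (N , p) = N , trans (sym (T^-cong N x≈y)) p

    -- The difference of two orbits.

    record Offset (y g : Carrier) (b : ℤ) (s : Carrier) : Set ℓ₁ where
      constructor _,_
      field
        -- `b` is an index and `a` is not, because the bounds and the descent concern `b` only.
        a  : ℤ
        s≈ : s ≈ y + (fromℤ a - fromℤ b * β) + g

    Offset-cong : ∀ {y y′ g g′ b s} → y ≈ y′ → g ≈ g′ → Offset y g b s → Offset y′ g′ b s
    Offset-cong y≈y′ g≈g′ (a , p) = a , trans p (+-cong (+-congʳ y≈y′) g≈g′)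

    -- `e` is a visibly positive form of `x + 1`, and an integer above -1 is at least 0.
    0≤i-by : ∀ {i x e} → fromℤ i ≈ x → 0# < e → x + 1# ≈ e → + 0 ℤ.≤ i
    0≤i-by i≈x 0<e x+1≈e = fromℤ-<+1 (<-respʳ-≈ (sym (trans (+-congʳ i≈x) x+1≈e)) 0<e)

    0≤bγ : ∀ {b} → + 0 ℤ.≤ b → 0# ≤ fromℤ b * γ
    0≤bγ 0≤b = nonNeg*nonNeg (fromℤ-mono-≤ 0≤b) (<⇒≤ 0<γ)

    abstract
      -- By `β² = m β + n`, `B (a - b β) = b n - (a - b m) β`, and the digits subtracted by the two
      -- applications of `T` only affect the integer part. Eliminating `a` from `a - b m` gives the
      -- recurrence.
      Offset-T : ∀ {y g b s} → Offset y g b s →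
        ∃[ b′ ] Offset (T y) (B * g) b′ (T s) × fromℤ b′ ≈ s - y - g + fromℤ b * γ
      Offset-T {y} {g} {b} {s} (a , p) =
        a ℤ.- b ℤ.* m , (d y 0 ℤ.- d s 0 ℤ.+ b ℤ.* n , q) , coeff
        where
        coeff : fromℤ (a ℤ.- b ℤ.* m) ≈ s - y - g + fromℤ b * γ
        coeff = trans (trans (fromℤ-- a (b ℤ.* m)) (+-congˡ (-‿cong (fromℤ-* b m))))
          (≈-by-multiple (- 1#) p
            (solve 7 (λ β μ s y g a b → a :- b :* μ :=
               s :- y :- g :+ b :* (β :- μ)
               :+ (:- con (+ 1)) :* (s :- (y :+ (a :- b :* β) :+ g)))
              refl β μ s y g (fromℤ a) (fromℤ b)))

        q : T s ≈ T y + (fromℤ (d y 0 ℤ.- d s 0 ℤ.+ b ℤ.* n) - fromℤ (a ℤ.- b ℤ.* m) * β) + B * g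
        q = trans
          (≈-by-multiple B p (≈-by-multiple (fromℤ b) βγ≈ν
            (solve 10 (λ β μ ν s y g a b D E → (:- β) :* s :- E :=
               (:- β) :* y :- D :+ (D :- E :+ b :* ν :- (a :- b :* μ) :* β) :+ (:- β) :* g
               :+ (:- β) :* (s :- (y :+ (a :- b :* β) :+ g))
               :+ b :* (β :* (β :- μ) :- ν))
              refl β μ ν s y g (fromℤ a) (fromℤ b) (fromℤ (d y 0)) (fromℤ (d s 0)))))
          (sym (+-congʳ (+-congˡ (+-cong
            (trans (fromℤ-+ (d y 0 ℤ.- d s 0) (b ℤ.* n)) (+-cong (fromℤ-- (d y 0) (d s 0)) (fromℤ-* b n)))
            (-‿cong (*-congʳ (trans (fromℤ-- a (b ℤ.* m)) (+-congˡ (-‿cong (fromℤ-* b m))))))))))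

      -- As `rᵦ - lᵦ = 1`, the recurrence plus 1 is `(rᵦ - y) + (s - lᵦ) - g + b γ`, whose first
      -- term is positive and whose others are nonnegative.
      Offset-T⁺ : ∀ {y g b s} → + 0 ℤ.≤ b → 0# ≤ - g → InRange y → InRange s → Offset y g b s →
        ∃[ b′ ] + 0 ℤ.≤ b′ × Offset (T y) (B * g) b′ (T s) × fromℤ b′ ≈ s - y - g + fromℤ b * γ
      Offset-T⁺ {y} {g} {b} {s} 0≤b 0≤-g (_ , y<r) (l≤s , _) o =
        let b′ , o′ , eq = Offset-T o in
        b′ , 0≤i-by eq
          (pos+nonNeg (pos+nonNeg (pos+nonNeg (0<y-x y<r) (0≤y-x l≤s)) 0≤-g) (0≤bγ 0≤b))
          (solve 5 (λ s y g x l → s :- y :- g :+ x :+ con (+ 1) :=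
             con (+ 1) :+ l :- y :+ (s :- l) :+ :- g :+ x) refl s y g (fromℤ b * γ) lᵦ) ,
        o′ , eq

    0≤-0 : 0# ≤ - 0#
    0≤-0 = inj₂ (sym -0#≈0#)

    0-inRange : InRange 0#
    0-inRange = <⇒≤ lᵦ<0 , 0<rᵦ

    -- The interval lies strictly between -1 and 1.
    integer-inRange : ∀ {a} → InRange (fromℤ a) → a ≡ + 0
    integer-inRange {a} (l≤a , a<r) = ℤ.≤-antisym
      (fromℤ-<+1 (<-trans a<r (<-by-gap (0<y-x lᵦ<0)
        (solve 1 (λ l → con (+ 0) :+ con (+ 1) := con (+ 1) :+ l :+ (con (+ 0) :- l)) refl lᵦ))))
      (0≤i-by refl (pos+nonNeg 0<rᵦ (0≤y-x l≤a))
        (solve 2 (λ a l → a :+ con (+ 1) := con (+ 1) :+ l :+ (a :- l)) refl (fromℤ a) lᵦ))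

    -- With both `y` and `g` equal to 0, `b′ = s + b γ < (1 - γ) + b γ ≤ b` for `b ≥ 1`; at `b = 0`
    -- the number `s` is an integer. Since `b′` is only known to be smaller, `bound` carries the
    -- structural recursion.
    lattice-hits0 : ∀ bound b {s} → b ℕ.≤ bound → InRange s → Offset 0# 0# (+ b) s → Hits0 s
    lattice-hits0 _ zero {s} _ (l≤s , s<r) (a , p) =
      0 , trans s≈a (reflexive (≡.cong fromℤ (integer-inRange {a} (≤-respʳ-≈ s≈a l≤s , <-respˡ-≈ s≈a s<r))))
      where
      s≈a : s ≈ fromℤ a
      s≈a = trans p (solve 2 (λ a β → con (+ 0) :+ (a :- con (+ 0) :* β) :+ con (+ 0) := a) refl (fromℤ a) β)
    lattice-hits0 (suc bound) (suc b) {s} (ℕ.s≤s b≤bound) s∈@(_ , s<r) o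
      with Offset-T⁺ (ℤ.+≤+ ℕ.z≤n) 0≤-0 0-inRange s∈ o
    ... | + b′ , _ , o′ , eq = Hits0-T⁻¹
      (lattice-hits0 bound b′ (ℕ.≤-trans (ℕ.s≤s⁻¹ (ℤ.drop‿+<+ b′<1+b)) b≤bound) (T-inRange s)
        (Offset-cong (T[0]≈0 refl) (zeroʳ B) o′))
      where
      b′<1+b : + b′ ℤ.< + suc b
      b′<1+b = fromℤ-cancel-< (<-by-gap
        (pos+nonNeg (pos+nonNeg (0<y-x s<r) (0≤y-x rᵦ≤1-γ))
          (nonNeg*nonNeg (0≤fromℕ b) (<⇒≤ 0<1-γ)))
        (trans
          (solve 4 (λ s l b γ → con (+ 1) :+ b :=
            s :- con (+ 0) :- con (+ 0) :+ (con (+ 1) :+ b) :* γ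
            :+ (con (+ 1) :+ l :- s :+ (con (+ 1) :- γ :- (con (+ 1) :+ l)) :+ b :* (con (+ 1) :- γ)))
            refl s lᵦ (fromℤ (+ b)) γ)
          (+-congʳ (sym eq))))

    -- Both orbits are run until that of `y` is at 0, with `Offset-T⁺` keeping the coefficient
    -- nonnegative; `lattice-hits0` takes over there.
    translate-hits0 : ∀ N {y b s} → T^ N y ≈ 0# → + 0 ℤ.≤ b →
      InRange y → InRange s → Offset y 0# b s → Hits0 s
    translate-hits0 zero    {b = + b} y≈0 _ _ s∈ o =
      lattice-hits0 b b ℕ.≤-refl s∈ (Offset-cong y≈0 refl o)
    translate-hits0 (suc N) {y} {b} {s} p 0≤b y∈ s∈ o with Offset-T⁺ 0≤b 0≤-0 y∈ s∈ o
    ... | _ , 0≤b′ , o′ , _ = Hits0-T⁻¹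
      (translate-hits0 N (trans (reflexive (≡.sym (T^-suc N y))) p) 0≤b′
        (T-inRange y) (T-inRange s) (Offset-cong refl (zeroʳ B) o′))

    -- Adding an even negative power of `B`.

    B≉0 : B ≉ 0#
    B≉0 B≈0 = pos⇒≉0 0<β (trans (sym (-‿involutive β)) (trans (-‿cong B≈0) -0#≈0#))

    -- `G ^ j` is `B ^ (-2 j)`: an even exponent makes the added power positive, and it is at most
    -- 1.
    J G : Carrier
    J = B ⁻¹
    G = J * J

    BJ≈1 : B * J ≈ 1#
    BJ≈1 = ⁻¹-inverseʳ B≉0

    βκ≈1 : β * κ ≈ 1#
    βκ≈1 = trans (solve 2 (λ β j → β :* (:- j) := (:- β) :* j) refl β J) BJ≈1

    0<κ : 0# < κ
    0<κ = pos-factor 0<β (<-respʳ-≈ (sym βκ≈1) 0<1)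

    0<1-κ : 0# < 1# - κ
    0<1-κ = pos-factor 0<β (<-respʳ-≈ (sym eq) (0<y-x 1<β))
      where
      eq : β * (1# - κ) ≈ β - 1#
      eq = ≈-by-multiple (- 1#) βκ≈1
        (solve 2 (λ β κ → β :* (con (+ 1) :- κ) :=
           β :- con (+ 1) :+ (:- con (+ 1)) :* (β :* κ :- con (+ 1))) refl β κ)

    0<G : 0# < G
    0<G = <-respʳ-≈ (solve 1 (λ j → (:- j) :* (:- j) := j :* j) refl J) (*-pos 0<κ 0<κ)

    0<1-G : 0# < 1# - G
    0<1-G = <-respʳ-≈ (solve 1 (λ j → con (+ 1) :- (:- j) :+ (:- j) :* (con (+ 1) :- (:- j)) := con (+ 1) :- j :* j) refl J)
      (pos+pos 0<1-κ (*-pos 0<κ 0<1-κ))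

    0<G^ : ∀ j → 0# < G ^ j
    0<G^ zero    = 0<1
    0<G^ (suc j) = *-pos 0<G (0<G^ j)

    0≤1-G^ : ∀ j → 0# ≤ 1# - G ^ j
    0≤1-G^ zero    = inj₂ (sym (-‿inverseʳ 1#))
    0≤1-G^ (suc j) = ≤-respʳ-≈
      (solve 2 (λ g h → con (+ 1) :- g :+ g :* (con (+ 1) :- h) := con (+ 1) :- g :* h) refl G (G ^ j))
      (nonNeg+nonNeg (<⇒≤ 0<1-G) (nonNeg*nonNeg (<⇒≤ 0<G) (0≤1-G^ j)))

    -- While the added power of B is positive the coefficient may drop to -1 ;
    -- then y + g exceeds rᵦ, and one step later the coefficient recovers.
    addPower-hits0 : ∀ j {y b s} → Hits0 y → + 0 ℤ.≤ b →
      InRange y → InRange s → Offset y (G ^ j) b s → Hits0 s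
    addPower-hits0 zero {y} {b} {s} (N , p) 0≤b y∈ s∈ (a , q) =
      -- At `j = 0` the power is the integer 1 and is absorbed into `a`.
      translate-hits0 N {b = b} p 0≤b y∈ s∈ (a ℤ.+ + 1 , trans q (trans
        (solve 4 (λ y a x o → y :+ (a :- x) :+ o := y :+ (a :+ o :- x) :+ con (+ 0)) refl
          y (fromℤ a) (fromℤ b * β) 1#)
        (+-congʳ (+-congˡ (+-congʳ (sym (trans (fromℤ-+ a (+ 1)) (+-congˡ fromℤ-1))))))))
    addPower-hits0 (suc j) {y} {b} {s} hy 0≤b y∈@(_ , y<r) s∈@(l≤s , _) o =
      Hits0-T⁻¹ (Hits0-T⁻¹ (addPower-hits0 j (Hits0-T (Hits0-T hy)) 0≤b₂
        (T-inRange _) (T-inRange _) (Offset-cong refl BBg≈G^j o₂)))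
      where
      g = G ^ suc j

      0<g = 0<G^ (suc j)

      -- Two steps of `T` multiply the power by `B * B`, which lowers the exponent of `G` by one.
      BBg≈G^j : B * (B * g) ≈ G ^ j
      BBg≈G^j = ≈-by-multiple (G ^ j * (1# + B * J)) BJ≈1
        (solve 3 (λ b j h → b :* (b :* (j :* j :* h)) :=
          h :+ h :* (con (+ 1) :+ b :* j) :* (b :* j :- con (+ 1))) refl B J (G ^ j))

      step₁ = Offset-T o
      b₁ = proj₁ step₁
      o₁ = proj₁ (proj₂ step₁)
      eq₁ = proj₂ (proj₂ step₁)

      step₂ = Offset-T o₁
      b₂ = proj₁ step₂
      o₂ = proj₁ (proj₂ step₂)
      eq₂ = proj₂ (proj₂ step₂)

      -- The term `- g` is now negative but at least -1, so the bound is one weaker than in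
      -- `Offset-T⁺`.
      -1≤b₁ : -[1+ 0 ] ℤ.≤ b₁
      -1≤b₁ = fromℤ-<+1 (<-by-gap
        (pos+nonNeg (pos+nonNeg (pos+nonNeg (0<y-x y<r) (0≤y-x l≤s)) (0≤1-G^ (suc j))) (0≤bγ 0≤b))
        (trans (+-congʳ eq₁)
          (solve 5 (λ s y g x l → s :- y :- g :+ x :+ con (+ 1) :=
            :- (con (+ 1) :+ con (+ 0)) :+ (con (+ 1) :+ l :- y :+ (s :- l) :+ (con (+ 1) :- g) :+ x))
            refl s y g (fromℤ b * γ) lᵦ)))

      Ts-l = 0≤y-x (proj₁ (T-inRange s))

      -- The variable `i` stands for `b₁` so that its sign can be matched on. If `b₁ ≥ 0`, the power
      -- is now `B * g < 0` and the estimate of `Offset-T⁺` works again.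
      0≤b₂′ : ∀ i → i ≡ b₁ → -[1+ 0 ] ℤ.≤ i → + 0 ℤ.≤ b₂
      0≤b₂′ (+ i) i≡b₁ _ = 0≤i-by eq₂
        (pos+nonNeg (pos+nonNeg (pos+nonNeg (*-pos 0<β 0<g) Ts-l) (<⇒≤ (0<y-x (proj₂ (T-inRange y)))))
          (0≤bγ (≡.subst (+ 0 ℤ.≤_) i≡b₁ (ℤ.+≤+ ℕ.z≤n))))
        (solve 6 (λ s y g β x l → s :- y :- (:- β) :* g :+ x :+ con (+ 1) :=
          β :* g :+ (s :- l) :+ (con (+ 1) :+ l :- y) :+ x) refl (T s) (T y) g β (fromℤ b₁ * γ) lᵦ)
      -- `b₁ = -1` means `y + g = 1 + s + b γ`. Substituting this and `T y = B y - D`, with `D ≥ 0`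
      -- the digit of `y`, gives `b₂ + 1 = (1 - γ) + (T s - lᵦ) + β (s - lᵦ) + β b γ + D`.
      0≤b₂′ -[1+ zero ] i≡b₁ _ = 0≤i-by eq₂
        (pos+nonNeg (pos+nonNeg (pos+nonNeg (pos+nonNeg 0<1-γ Ts-l)
          (nonNeg*nonNeg (<⇒≤ 0<β) (0≤y-x l≤s))) (nonNeg*nonNeg (<⇒≤ 0<β) (0≤bγ 0≤b)))
          (fromℤ-mono-≤ (0≤d₀ y<r)))
        (≈-by-multiple β eq₁ (≈-by-multiple (β - γ) -1≈b₁ (≈-by-multiple 1# lᵦ≈-βrᵦ
          (solve 10 (λ s Ts y g β γ l b b₁ D →
            Ts :- ((:- β) :* y :- D) :- (:- β) :* g :+ b₁ :* γ :+ con (+ 1) :=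
            con (+ 1) :- γ :+ (Ts :- l) :+ β :* (s :- l) :+ β :* (b :* γ) :+ D
            :+ β :* (b₁ :- (s :- y :- g :+ b :* γ))
            :+ (β :- γ) :* (:- (con (+ 1) :+ con (+ 0)) :- b₁)
            :+ con (+ 1) :* (l :- (:- (β :* (con (+ 1) :+ l)))))
            refl s (T s) y g β γ lᵦ (fromℤ b) (fromℤ b₁) (fromℤ (d y 0))))))
        where
        -1≈b₁ : fromℤ -[1+ 0 ] ≈ fromℤ b₁
        -1≈b₁ = reflexive (≡.cong fromℤ i≡b₁)
      0≤b₂′ -[1+ suc _ ] _ (ℤ.-≤- ())

      0≤b₂ : + 0 ℤ.≤ b₂
      0≤b₂ = 0≤b₂′ b₁ ≡.refl -1≤b₁

    -- Interior points and leading zeros.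

    InInterior : Carrier → Set _
    InInterior y = lᵦ < y × y < rᵦ

    interior⇒inRange : ∀ {y} → InInterior y → InRange y
    interior⇒inRange (l<y , y<r) = <⇒≤ l<y , y<r

    -- `J` maps `lᵦ` to `rᵦ`, so the upper gap is `κ (y - lᵦ)` and the left end has to be excluded.
    J*-interior : ∀ {y} → InInterior y → InInterior (J * y)
    J*-interior {y} (l<y , y<r) =
      <-by-gap (pos+pos (*-pos 0<κ (0<y-x y<r)) (*-pos 0<κ (0<y-x 1<β)))
        (≈-by-multiple J lᵦ≈-βrᵦ (≈-by-multiple lᵦ βκ≈1
          (solve 4 (λ j y β l → j :* y :=
            l :+ ((:- j) :* (con (+ 1) :+ l :- y) :+ (:- j) :* (β :- con (+ 1)))
            :+ j :* (l :- (:- (β :* (con (+ 1) :+ l))))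
            :+ l :* (β :* (:- j) :- con (+ 1))) refl J y β lᵦ))) ,
      <-by-gap (*-pos 0<κ (0<y-x l<y))
        (≈-by-multiple (- J) lᵦ≈-βrᵦ (≈-by-multiple (- rᵦ) βκ≈1
          (solve 4 (λ j y β l → con (+ 1) :+ l :=
            j :* y :+ (:- j) :* (y :- l)
            :+ (:- j) :* (l :- (:- (β :* (con (+ 1) :+ l))))
            :+ (:- (con (+ 1) :+ l)) :* (β :* (:- j) :- con (+ 1))) refl J y β lᵦ)))

    B[Jy]≈y : ∀ y → B * (J * y) ≈ y
    B[Jy]≈y y = trans (sym (*-assoc B J y)) (trans (*-congʳ BJ≈1) (*-identityˡ y))

    -- Division by `B` prepends a zero digit: the number under the floor is `y - lᵦ`, in (0, 1).
    T[Jy]≈y : ∀ {y} → InInterior y → T (J * y) ≈ y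
    T[Jy]≈y {y} (l<y , y<r) = trans
      (T-shift
        (≤-respʳ-≈ (+-congʳ (sym (B[Jy]≈y y))) (<⇒≤ (0<y-x l<y)))
        (<-respˡ-≈ (+-congʳ (sym (B[Jy]≈y y)))
          (<-by-gap (0<y-x y<r)
            (solve 2 (λ y l → con (+ 1) := y :- l :+ (con (+ 1) :+ l :- y)) refl y lᵦ))))
      (B[Jy]≈y y)

    Terminating : Carrier → Set _
    Terminating y = InInterior y × Hits0 y

    J*-terminating : ∀ {y} → Terminating y → Terminating (J * y)
    J*-terminating (y∈ , hy) =
      J*-interior y∈ , Hits0-T⁻¹ (Hits0-cong (sym (T[Jy]≈y y∈)) hy)

    Terminating-cong : ∀ {x y} → x ≈ y → Terminating x → Terminating y
    Terminating-cong x≈y ((l<x , x<r) , hx) =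
      (<-respʳ-≈ x≈y l<x , <-respˡ-≈ x≈y x<r) , Hits0-cong x≈y hx

    J^*-terminating : ∀ i {y} → Terminating y → Terminating (J ^ i * y)
    J^*-terminating zero    ty = Terminating-cong (sym (*-identityˡ _)) ty
    J^*-terminating (suc i) ty =
      Terminating-cong (sym (*-assoc _ _ _)) (J*-terminating (J^*-terminating i ty))

    -- Finite numbers and what may be added to them.

    Finite : Carrier → Set _
    Finite x = ∃[ k ] ∃[ y ] Terminating y × x ≈ B ^ℤ k * y

    Finite-cong : ∀ {x x′} → x ≈ x′ → Finite x → Finite x′
    Finite-cong x≈x′ (k , y , ty , x≈) = k , y , ty , trans (sym x≈x′) x≈

    Finite-0 : Finite 0#
    Finite-0 = + 0 , 0# , ((lᵦ<0 , 0<rᵦ) , 0 , refl) , sym (zeroʳ _)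

    Finite-scale : ∀ e {x} → Finite x → Finite (B ^ℤ e * x)
    Finite-scale e (k , y , ty , x≈) = e ℤ.+ k , y , ty ,
      trans (*-congˡ x≈) (trans (sym (*-assoc _ _ _)) (*-congʳ (sym (^ℤ-+ B≉0 e k))))

    B^J^≈1 : ∀ i → B ^ i * J ^ i ≈ 1#
    B^J^≈1 = ^-inverse BJ≈1

    -- Extra factors of `B` are traded for leading zeros: `B ^ i y = B ^ (2 i) (J ^ i y)`. The even
    -- exponent lets 1 be written as `B ^ (j + j)` times the positive number `G ^ j`.
    Finite⇒even : ∀ {x} → Finite x → ∃[ j ] ∃[ y ] Terminating y × x ≈ B ^ (j ℕ.+ j) * y
    Finite⇒even (+ i , y , ty , x≈) = i , J ^ i * y , J^*-terminating i ty , trans x≈ (sym (begin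
      B ^ (i ℕ.+ i) * (J ^ i * y)       ≈⟨ *-congʳ (^-homo-* B i i) ⟩
      B ^ i * B ^ i * (J ^ i * y)       ≈⟨ solve 3 (λ b j y → b :* b :* (j :* y) := b :* j :* (b :* y)) refl (B ^ i) (J ^ i) y ⟩
      B ^ i * J ^ i * (B ^ i * y)       ≈⟨ *-congʳ (B^J^≈1 i) ⟩
      1# * (B ^ i * y)                  ≈⟨ *-identityˡ _ ⟩
      B ^ i * y                         ∎))
    Finite⇒even (-[1+ i ] , y , ty , x≈) =
      0 , J ^ suc i * y , J^*-terminating (suc i) ty , trans x≈ (sym (*-identityˡ _))

    -- The value is `(ν - 1) + β (μ - 1)`, and `μ ≥ ν ≥ 1`.
    0≤β²-β-1 : 0# ≤ β * β - β - 1#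
    0≤β²-β-1 = ≤-respʳ-≈ (sym eq)
      (nonNeg+nonNeg (0≤y-x 1≤ν) (nonNeg*nonNeg (<⇒≤ 0<β) (nonNeg+nonNeg 0≤μ-ν (0≤y-x 1≤ν))))
      where
      1≤ν : 1# ≤ ν
      1≤ν = ≤-respˡ-≈ fromℤ-1 (fromℤ-mono-≤ 1≤n)
      eq : β * β - β - 1# ≈ ν - 1# + β * (μ - ν + (ν - 1#))
      eq = ≈-by-multiple 1# βγ≈ν
        (solve 3 (λ β μ ν → β :* β :- β :- con (+ 1) :=
          ν :- con (+ 1) :+ β :* (μ :- ν :+ (ν :- con (+ 1)))
          :+ con (+ 1) :* (β :* (β :- μ) :- ν)) refl β μ ν)

    β²G≈1 : β * β * G ≈ 1#
    β²G≈1 = ≈-by-multiple (1# + β * κ) βκ≈1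
      (solve 2 (λ β j → β :* β :* (j :* j) :=
        con (+ 1) :+ (con (+ 1) :+ β :* (:- j)) :* (β :* (:- j) :- con (+ 1))) refl β J)

    -- Equivalently `β ^ 4 ≥ 2 (β + 1)`, which follows from `β² ≥ β + 1` and `β² ≥ 2`.
    2G²≤rᵦ : G * G + G * G ≤ rᵦ
    2G²≤rᵦ = ≤-respʳ-≈ (sym rᵦ≈ρ) (≤-by-gap
      (nonNeg+nonNeg
        (nonNeg*nonNeg (<⇒≤ (*-pos 0<ρ 0<G)) 0≤β²-β-1)
        (nonNeg*nonNeg (<⇒≤ (*-pos 0<G 0<G)) (nonNeg+nonNeg 0≤β²-β-1 (<⇒≤ (0<y-x 1<β)))))
      (≈-by-multiple (- (ρ + G)) β²G≈1 (≈-by-multiple G [β+1]ρ≈1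
        (solve 3 (λ β ρ g → ρ :=
          g :* g :+ g :* g
          :+ (ρ :* g :* (β :* β :- β :- con (+ 1))
              :+ g :* g :* (β :* β :- β :- con (+ 1) :+ (β :- con (+ 1))))
          :+ (:- (ρ :+ g)) :* (β :* β :* g :- con (+ 1))
          :+ g :* ((β :+ con (+ 1)) :* ρ :- con (+ 1))) refl β ρ G))))

    -- The factor `G * G` keeps the sum in the interval: `y + G ^ j < 2`, so `2G²≤rᵦ` bounds it
    -- above, and below it exceeds `G² lᵦ ≥ lᵦ`. The orbits of `G² y` and of the sum are then
    -- compared from the offset `a = b = 0`.
    G²y+G^-terminating : ∀ j {y} → Terminating y → Terminating (G * (G * y) + G ^ suc (suc j))
    G²y+G^-terminating j {y} ty@((l<y , y<r) , _) = s∈ ,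
      addPower-hits0 (suc (suc j)) {b = + 0} hy (ℤ.+≤+ ℕ.z≤n) (interior⇒inRange G²y∈) (interior⇒inRange s∈)
        (+ 0 , +-congʳ (solve 2 (λ y β → y := y :+ (con (+ 0) :- con (+ 0) :* β)) refl _ β))
      where
      h = G ^ j
      G²y≈ : J ^ 4 * y ≈ G * (G * y)
      G²y≈ = solve 2 (λ j y → j :* (j :* (j :* (j :* con (+ 1)))) :* y := j :* j :* (j :* j :* y)) refl J y

      ty′ = Terminating-cong G²y≈ (J^*-terminating 4 ty)
      G²y∈ = proj₁ ty′
      hy = proj₂ ty′

      s∈ : InInterior (G * (G * y) + G ^ suc (suc j))
      s∈ =
        <-by-gap
          (pos+nonNeg (pos+pos (*-pos (*-pos 0<G 0<G) (0<y-x l<y)) (0<G^ (suc (suc j))))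
            (nonNeg*nonNeg (0≤y-x (<⇒≤ lᵦ<0)) (0≤1-G^ 2)))
          (solve 4 (λ g y h l → g :* (g :* y) :+ g :* (g :* h) :=
            l :+ (g :* g :* (y :- l) :+ g :* (g :* h)
                  :+ (con (+ 0) :- l) :* (con (+ 1) :- g :* (g :* con (+ 1))))) refl G y h lᵦ) ,
        <-by-gap
          (pos+nonNeg
            (*-pos (*-pos 0<G 0<G) (pos+nonNeg (pos+pos (0<y-x y<r) (0<y-x lᵦ<0)) (0≤1-G^ j)))
            (0≤y-x 2G²≤rᵦ))
          (solve 4 (λ g y h l → con (+ 1) :+ l :=
            g :* (g :* y) :+ g :* (g :* h)
            :+ (g :* g :* (con (+ 1) :+ l :- y :+ (con (+ 0) :- l) :+ (con (+ 1) :- h))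
                :+ (con (+ 1) :+ l :- (g :* g :+ g :* g)))) refl G y h lᵦ)

    -- `B ^ (2 j + 4) (G² y + G ^ (j + 2)) = B ^ (2 j) y +
    -- 1`: the spare powers of `B` undo the shrinking by `G * G`.
    even-+1 : ∀ {x} → ∃[ j ] ∃[ y ] Terminating y × x ≈ B ^ (j ℕ.+ j) * y → Finite (x + 1#)
    even-+1 {x} (j , y , ty , x≈) = + (i ℕ.+ i) , _ , G²y+G^-terminating j ty , sym (begin
      B ^ (i ℕ.+ i) * (G * (G * y) + G ^ i)
        ≈⟨ *-congʳ (B^2≈ i) ⟩
      B * B * (B * B * (B * B) ^ j) * (G * (G * y) + G * (G * G ^ j))
        ≈⟨ solve 5 (λ b J y p q → b :* b :* (b :* b :* p) :* (J :* J :* (J :* J :* y) :+ J :* J :* (J :* J :* q)) :=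
             b :* J :* (b :* J) :* (b :* J :* (b :* J)) :* (p :* y :+ p :* q)) refl B J y ((B * B) ^ j) (G ^ j) ⟩
      B * J * (B * J) * (B * J * (B * J)) * ((B * B) ^ j * y + (B * B) ^ j * G ^ j)
        ≈⟨ *-cong (*-cong (*-cong BJ≈1 BJ≈1) (*-cong BJ≈1 BJ≈1)) (+-cong
             (trans (*-congʳ (sym (B^2≈ j))) (sym x≈))
             (^-inverse (trans (solve 2 (λ b J → b :* b :* (J :* J) := b :* J :* (b :* J)) refl B J)
               (trans (*-cong BJ≈1 BJ≈1) (*-identityˡ 1#))) j)) ⟩
      1# * 1# * (1# * 1#) * (x + 1#)
        ≈⟨ solve 1 (λ x → con (+ 1) :* con (+ 1) :* (con (+ 1) :* con (+ 1)) :* x := x) refl (x + 1#) ⟩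
      x + 1#  ∎)
      where
      i = suc (suc j)
      B^2≈ : ∀ i → B ^ (i ℕ.+ i) ≈ (B * B) ^ i
      B^2≈ i = trans (^-homo-* B i i) (sym (^-distrib-* B B i))

    Finite-+1 : ∀ {x} → Finite x → Finite (x + 1#)
    Finite-+1 fx = even-+1 (Finite⇒even fx)

    -- Quantifying over every finite `x` makes the property additive in `u`, so that it spreads from
    -- 1 to digit sums.
    Addable : Carrier → Set _
    Addable u = ∀ {x} → Finite x → Finite (x + u)

    Addable-cong : ∀ {u v} → u ≈ v → Addable u → Addable v
    Addable-cong u≈v au fx = Finite-cong (+-congˡ u≈v) (au fx)

    Addable-0 : Addable 0#
    Addable-0 = Finite-cong (sym (+-identityʳ _))

    Addable-+ : ∀ {u v} → Addable u → Addable v → Addable (u + v)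
    Addable-+ au av fx = Finite-cong (+-assoc _ _ _) (av (au fx))

    Addable-fromℤ : ∀ {i} → + 0 ℤ.≤ i → Addable (fromℤ i)
    Addable-fromℤ {+ zero}  _ = Addable-0
    Addable-fromℤ {+ suc i} _ = Addable-+ Finite-+1 (Addable-fromℤ {+ i} (ℤ.+≤+ ℕ.z≤n))

    -- `x + B ^ e u = B ^ e (B ^ (- e) x + u)`, and finiteness survives both scalings.
    Addable-scale : ∀ e {u} → Addable u → Addable (B ^ℤ e * u)
    Addable-scale e {u} au {x} fx = Finite-cong
      (begin
        B ^ℤ e * (B ^ℤ (ℤ.- e) * x + u)           ≈⟨ distribˡ _ _ _ ⟩
        B ^ℤ e * (B ^ℤ (ℤ.- e) * x) + B ^ℤ e * u  ≈⟨ +-congʳ (*-assoc _ _ _) ⟨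
        B ^ℤ e * B ^ℤ (ℤ.- e) * x + B ^ℤ e * u    ≈⟨ +-congʳ (*-congʳ (^ℤ-+ B≉0 e (ℤ.- e))) ⟨
        B ^ℤ (e ℤ.- e) * x + B ^ℤ e * u           ≡⟨ ≡.cong (λ i → B ^ℤ i * x + B ^ℤ e * u) (ℤ.+-inverseʳ e) ⟩
        1# * x + B ^ℤ e * u                       ≈⟨ +-congʳ (*-identityˡ x) ⟩
        x + B ^ℤ e * u                            ∎)
      (Finite-scale e (au (Finite-scale (ℤ.- e) fx)))

    Addable-sum : ∀ {N} (t : Fin N → Carrier) → (∀ i → Addable (t i)) → Addable (sum t)
    Addable-sum {zero}  t at = Addable-0
    Addable-sum {suc N} t at = Addable-+ (at Fin.zero) (Addable-sum (λ i → t (Fin.suc i)) (λ i → at (Fin.suc i)))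

    -- Finite digit sums.

    partialSum-suc : ∀ k a N →
      partialSum k a (suc N) ≈ fromℤ (a 0) * B ^ℤ k + partialSum (ℤ.pred k) (λ j → a (suc j)) N
    partialSum-suc k a N = +-cong
      (*-congˡ (reflexive (≡.cong (B ^ℤ_) (ℤ.+-identityʳ k))))
      (sum-cong-≋ +-monoid {N} (λ j → *-congˡ (reflexive (≡.cong (B ^ℤ_)
        (≡.trans (ℤ.minus-suc k (toℕ j)) (≡.sym (ℤ.pred-+ k (ℤ.- + toℕ j))))))))

    partialSum-cong : ∀ k {a a′} N → (∀ j → a j ≡ a′ j) → partialSum k a N ≈ partialSum k a′ N
    partialSum-cong k N a≡a′ =
      sum-cong-≋ +-monoid {N} (λ j → *-congʳ (reflexive (≡.cong fromℤ (a≡a′ (toℕ j)))))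

    partialSum-stable : ∀ k a {M N} → M ℕ.≤ N → (∀ j → M ℕ.≤ j → a j ≡ + 0) →
      partialSum k a N ≈ partialSum k a M
    partialSum-stable k a {zero} {zero}  _ _ = refl
    partialSum-stable k a {zero} {suc N} _ z = trans (partialSum-suc k a N)
      (trans (+-cong (trans (*-congʳ (reflexive (≡.cong fromℤ (z 0 ℕ.z≤n)))) (zeroˡ _))
                     (partialSum-stable (ℤ.pred k) (λ j → a (suc j)) {0} {N} ℕ.z≤n (λ j _ → z (suc j) ℕ.z≤n)))
             (+-identityˡ 0#))
    partialSum-stable k a {suc M} {suc N} (ℕ.s≤s M≤N) z = trans (partialSum-suc k a N)
      (trans (+-congˡ (partialSum-stable (ℤ.pred k) (λ j → a (suc j)) M≤N (λ j M≤j → z (suc j) (ℕ.s≤s M≤j))))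
             (sym (partialSum-suc k a M)))

    within-all⇒≈0 : ∀ {x} → (∀ ε → 0# < ε → (- ε < x) × (x < ε)) → x ≈ 0#
    within-all⇒≈0 {x} small with compare x 0#
    ... | tri< x<0 _ _ = ⊥-elim (<-irrefl (-‿involutive x)
            (proj₁ (small (- x) (<-respʳ-≈ (+-identityˡ (- x)) (0<y-x x<0)))))
    ... | tri≈ _ x≈0 _ = x≈0
    ... | tri> _ _ 0<x = ⊥-elim (<-irrefl refl (proj₂ (small x 0<x)))

    -- The partial sums are constant from `M` on, so their distance to `x` is below every positive
    -- `ε` and the limit is attained.
    finiteRepresentation : ∀ {x k a M} → IsRepresentation x k a → (∀ j → M ℕ.≤ j → a j ≡ + 0) →
      x ≈ partialSum k a M
    finiteRepresentation {x} {k} {a} {M} rep z =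
      trans (sym (+-identityʳ x)) (trans (+-congˡ (sym (within-all⇒≈0 small)))
        (solve 2 (λ x p → x :+ (p :- x) := p) refl x (partialSum k a M)))
      where
      small : ∀ ε → 0# < ε → (- ε < partialSum k a M - x) × (partialSum k a M - x < ε)
      small ε 0<ε with rep ε 0<ε
      -- The maximum is late enough for both closeness and stability.
      ... | N₀ , close with close (N₀ ℕ.⊔ M) (ℕ.m≤m⊔n N₀ M)
      ... | -ε< , <ε = <-respʳ-≈ stable -ε< , <-respˡ-≈ stable <ε
        where
        stable : partialSum k a (N₀ ℕ.⊔ M) - x ≈ partialSum k a M - x
        stable = +-congʳ (partialSum-stable k a (ℕ.m≤n⊔m N₀ M) z)

    -- Passing between `Fin₋ᵦ` and `Finite`.

    i<j⇒i-j<0 : ∀ {i j} → i ℤ.< j → i ℤ.- j ℤ.< + 0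
    i<j⇒i-j<0 i<j = ℤ.≰⇒> (λ 0≤i-j → ℤ.<⇒≱ i<j (ℤ.0≤i-j⇒j≤i 0≤i-j))

    i-j<0⇒i<j : ∀ {i j} → i ℤ.- j ℤ.< + 0 → i ℤ.< j
    i-j<0⇒i<j i-j<0 = ℤ.≰⇒> (λ j≤i → ℤ.<⇒≱ i-j<0 (ℤ.i≤j⇒0≤j-i j≤i))

    i<1+∣i∣ : ∀ i → i ℤ.< + suc ℤ.∣ i ∣
    i<1+∣i∣ (+ n)    = ℤ.+<+ ℕ.≤-refl
    i<1+∣i∣ -[1+ n ] = ℤ.-<+

    0≤d : ∀ {y} → y < rᵦ → ∀ j → + 0 ℤ.≤ d y j
    0≤d y<r zero    = 0≤d₀ y<r
    0≤d y<r (suc j) = 0≤d₀ (proj₂ (T-inRange _))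

    Fin⇒Addable : ∀ {x} → Fin₋ᵦ x → Addable x
    Fin⇒Addable (e , z , (k , a , (rep , y , _ , y<r , a≡d) , a≡0) , x≈) =
      Addable-cong (sym x≈) (Addable-scale e (Addable-cong
        -- An index beyond the absolute value of `k` has a negative exponent, so its digit is 0.
        (sym (finiteRepresentation {k = k} {a} {M = suc ℤ.∣ k ∣} rep
          (λ j k<j → a≡0 j (i<j⇒i-j<0 (ℤ.<-≤-trans (i<1+∣i∣ k) (ℤ.+≤+ k<j))))))
        (Addable-sum {suc ℤ.∣ k ∣} _ (λ i → Addable-cong (*-comm _ _)
          (Addable-scale (k ℤ.- + toℕ i) (Addable-fromℤ
            (≡.subst (+ 0 ℤ.≤_) (≡.sym (a≡d (toℕ i))) (0≤d y<r (toℕ i)))))))))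

    d-suc : ∀ y j → d y (suc j) ≡ d (T y) j
    d-suc y j = ≡.cong (λ t → ⌊ B * t - lᵦ ⌋) (T^-suc j y)

    -- The right-hand side is B ^ (k + 1) y : digit j of y has weight B ^ (-1 - j).
    partialSum-orbit : ∀ k N {y} → T^ N y ≈ 0# → partialSum k (d y) N ≈ B * (B ^ℤ k * y)
    partialSum-orbit k zero    {y} y≈0 =
      sym (trans (*-congˡ (trans (*-congˡ y≈0) (zeroʳ _))) (zeroʳ _))
    partialSum-orbit k (suc N) {y} p = begin
      partialSum k (d y) (suc N)
        ≈⟨ partialSum-suc k (d y) N ⟩
      fromℤ (d y 0) * B ^ℤ k + partialSum (ℤ.pred k) (λ j → d y (suc j)) N
        ≈⟨ +-congˡ (partialSum-cong (ℤ.pred k) N (d-suc y)) ⟩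
      fromℤ (d y 0) * B ^ℤ k + partialSum (ℤ.pred k) (d (T y)) N
        ≈⟨ +-congˡ (partialSum-orbit (ℤ.pred k) N (trans (reflexive (≡.sym (T^-suc N y))) p)) ⟩
      fromℤ (d y 0) * B ^ℤ k + B * (B ^ℤ ℤ.pred k * T y)
        ≈⟨ +-congˡ (trans (sym (*-assoc _ _ _)) (*-congʳ (trans (sym (^ℤ-suc B≉0 (ℤ.pred k)))
             (reflexive (≡.cong (B ^ℤ_) (ℤ.suc-pred k)))))) ⟩
      fromℤ (d y 0) * B ^ℤ k + B ^ℤ k * T y
        ≈⟨ solve 4 (λ D p b y → D :* p :+ p :* (b :* y :- D) := b :* (p :* y)) refl (fromℤ (d y 0)) (B ^ℤ k) B y ⟩
      B * (B ^ℤ k * y)  ∎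

    T^-stays0 : ∀ {y N j} → T^ N y ≈ 0# → N ℕ.≤′ j → T^ j y ≈ 0#
    T^-stays0 p ℕ.≤′-refl       = p
    T^-stays0 p (ℕ.≤′-step N≤j) = T[0]≈0 (T^-stays0 p N≤j)

    Finite⇒Fin : ∀ {x} → Finite x → Fin₋ᵦ x
    Finite⇒Fin {x} (e , y , ((l<y , y<r) , N , p) , x≈) =
      e ℤ.- + N , B * (B ^ℤ k * y) ,
      (k , d y , (represents , y , l<y , y<r , λ _ → ≡.refl) ,
        λ j k-j<0 → d≡0 (ℤ.drop‿+≤+ (≡.subst (ℤ._≤ + j) (ℤ.suc-pred (+ N))
          (ℤ.i<j⇒suc[i]≤j (i-j<0⇒i<j {k} {+ j} k-j<0))))) ,
      trans x≈ (sym (begin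
        B ^ℤ (e ℤ.- + N) * (B * (B ^ℤ k * y))  ≈⟨ *-congˡ (*-assoc _ _ _) ⟨
        B ^ℤ (e ℤ.- + N) * (B * B ^ℤ k * y)    ≈⟨ *-congˡ (*-congʳ (^ℤ-suc B≉0 k)) ⟨
        B ^ℤ (e ℤ.- + N) * (B ^ℤ ℤ.suc k * y)  ≡⟨ ≡.cong (λ i → B ^ℤ (e ℤ.- + N) * (B ^ℤ i * y)) (ℤ.suc-pred (+ N)) ⟩
        B ^ℤ (e ℤ.- + N) * (B ^ℤ + N * y)      ≈⟨ *-assoc _ _ _ ⟨
        B ^ℤ (e ℤ.- + N) * B ^ℤ + N * y        ≈⟨ *-congʳ (^ℤ-+ B≉0 (e ℤ.- + N) (+ N)) ⟨
        B ^ℤ (e ℤ.- + N ℤ.+ + N) * y           ≡⟨ ≡.cong (λ i → B ^ℤ i * y) cancel ⟩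
        B ^ℤ e * y                             ∎))
      where
      -- The first `N` digits get the exponents from `N - 1` down to 0, and the later ones vanish,
      -- so `B ^ N y` lies in `ℤ₋ᵦ`.
      k = ℤ.pred (+ N)

      cancel : e ℤ.- + N ℤ.+ + N ≡ e
      cancel = ≡.trans (ℤ.+-assoc e (ℤ.- + N) (+ N))
        (≡.trans (≡.cong (λ i → e ℤ.+ i) (ℤ.+-inverseˡ (+ N))) (ℤ.+-identityʳ e))

      stays0 : ∀ {j} → N ℕ.≤ j → T^ j y ≈ 0#
      stays0 N≤j = T^-stays0 p (ℕ.≤⇒≤′ N≤j)

      d≡0 : ∀ {j} → N ℕ.≤ j → d y j ≡ + 0
      d≡0 N≤j = d₀[0]≡0 (stays0 N≤j)

      represents : IsRepresentation (B * (B ^ℤ k * y)) k (d y)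
      represents ε 0<ε = N , λ M N≤M →
        let error≈0 = trans (+-congʳ (partialSum-orbit k M (stays0 N≤M))) (-‿inverseʳ _) in
        <-respʳ-≈ (sym error≈0) (<-respˡ-≈ (+-identityˡ (- ε)) (<-by-gap 0<ε
          (solve 1 (λ ε → con (+ 0) := con (+ 0) :- ε :+ ε) refl ε))) ,
        <-respˡ-≈ (sym error≈0) 0<ε

    Fin-+ : ∀ x y → Fin₋ᵦ x → Fin₋ᵦ y → Fin₋ᵦ (x + y)
    Fin-+ x y fx fy = Finite⇒Fin
      -- Adding `x` to 0 shows that `x` is finite, and then `y` is added to it.
      (Fin⇒Addable fy (Finite-cong (+-identityˡ x) (Fin⇒Addable fx Finite-0)))

theorem5p3 : ∀ {c ℓ₁ ℓ₂} (K : ArchimedeanOrderedField c ℓ₁ ℓ₂) →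
    let open ArchimedeanOrderedField K in
    (m n : ℤ) → n ℤ.≤ m → + 1 ℤ.≤ n →
    (β : Carrier) → 1# < β →
    β ^ 2 - fromℤ m * β - fromℤ n ≈ 0# →
    let open Expansion K β in
    ∀ x y → Fin₋ᵦ x → Fin₋ᵦ y → Fin₋ᵦ (x + y)
theorem5p3 = QuadraticBase.Fin-+
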